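{- Let $e\ge1$ and let $(V,\mathcal B_r)$ be a combinatorial $2e$-$(n,r,\lambda_{2e})$ design with $r\neq n-r$, and let $(V,\mathcal B_{n-r})$ be its complementary design, $\mathcal B_{n-r}=\{V\setminus B: B\in\mathcal B_r\}$. Let $\mathcal B=\mathcal B_r\cup\mathcal B_{n-r}$ and let $Y=Y_r\cup Y_{n-r}$ be the subset of $X$ on the two shells $X_r\cup X_{n-r}$ of $H(n,2)$ corresponding to the block set $\mathcal B$, i.e. $Y=\{x\in X: B_x\in\mathcal B\}$. Then $(Y,w)$ is a relative $(2e+1)$-design (with respect to $u_0$) with constant weight, namely with $w(y)=w$ for all $y\in Y$, where $w>0$ is a constant.
   Context: Let $V=\{1,\dots,n\}$, let $X=\{0,1\}^n$ be the point set of the binary Hamming scheme $H(n,2)$, $u_0=(0,\dots,0)$, and let the shell $X_r$ be the set of vectors in $X$ with exactly $r$ ones. For $x\in X$ put $B_x=\{i\in V: x_i=1\}$. If $Y\subset X_{r_1}\cup\dots\cup X_{r_p}$ with distinct $r_\nu$ and $w:Y\to\mathbb R_{>0}$, put $Y_{r_\nu}=Y\cap X_{r_\nu}$ and $w(Y_{r_\nu})=\sum_{y\in Y_{r_\nu}}w(y)$; then $(Y,w)$ is a relative $t$-design with respect to $u_0$ if for every $1\le j\le t$ and every $z\in X_j$ (with $X_j=\emptyset$ if $j>n$) $$\sum_{\nu=1}^p\frac{w(Y_{r_\nu})}{|X_{r_\nu}|}\sum_{x\in X_{r_\nu}}f_z(x)=\sum_{y\in Y}w(y)f_z(y),$$ where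 $f_z(x)=1$ if $B_z\subset B_x$ and $f_z(x)=0$ otherwise. (This is the definition via the P-structure; for $H(n,2)$ it coincides with the one via the Q-structure.) A combinatorial $s$-$(n,k,\lambda)$ design, $s\le k\le n$, is a pair $(V,\mathcal B)$ with $|V|=n$ and $\mathcal B$ a set of $k$-element subsets of $V$ such that every $s$-element subset of $V$ is contained in exactly $\lambda$ blocks. -}

module Defs where

open import Level using (Level; 0ℓ; _⊔_) renaming (suc to lsuc)
open import Algebra.Apartness.Bundles using (HeytingField)
import Algebra.Definitions
import Algebra.Definitions.RawSemiring
import Algebra.Properties.Ring
open import Algebra.Bundles using (CommutativeRing; Semiring)
open import Data.Bool.Base using (Bool; true; false; if_then_else_)
open import Data.Fin.Base using (Fin)
open import Data.Fin.Subset using (Subset; _⊆_; ∁; ∣_∣)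
open import Data.Fin.Subset.Properties using (_⊆?_; anySubset?)
open import Data.List.Base using (List; []; _∷_; _++_; map; filter; foldr; length)
open import Data.List.Membership.Propositional using (_∈_)
open import Data.List.Membership.Propositional.Properties
  using (∈-map⁺; ∈-++⁺ˡ; ∈-++⁺ʳ; ∈-filter⁺)
open import Data.List.Relation.Unary.Any using (here; there)
open import Data.Nat.Base as ℕ using (ℕ; zero; suc; _≤_; z≤n; s≤s; NonZero)
open import Data.Nat.Properties using (_≟_)
open import Data.Product.Base using (∃; ∃-syntax; _×_; _,_; proj₁; proj₂)
open import Data.Sum.Base using (_⊎_; inj₁; inj₂)
open import Data.Vec.Base using (Vec; []; _∷_)
open import Data.Vec.Properties using (≡-dec)
import Data.Bool.Properties as Bool
open import Function.Definitions using (Injective)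
open import Relation.Binary.Core using (Rel)
open import Relation.Binary.Structures using (IsStrictPartialOrder)
open import Relation.Binary.PropositionalEquality as ≡ using (_≡_; refl)
open import Relation.Nullary.Decidable using (does; _×-dec_)
open import Relation.Unary using (Pred; Decidable)

private
  variable
    n : ℕ

-- The real numbers, characterised axiomatically as an Archimedean,
-- Cauchy-complete ordered field.  Classically this determines ℝ up to
-- isomorphism; constructively the axioms hold for the (setoid) Cauchy reals.
record Reals c ℓ₁ ℓ₂ : Set (lsuc (c ⊔ ℓ₁ ⊔ ℓ₂)) where
  field
    heytingField : HeytingField c ℓ₁ ℓ₂

  open HeytingField heytingField public

  commutativeRing : CommutativeRing c ℓ₁
  commutativeRing = record { isCommutativeRing = isCommutativeRing }

  open CommutativeRing commutativeRing public using (ring; semiring)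
  open Semiring semiring public using (rawSemiring)
  open Algebra.Definitions.RawSemiring rawSemiring public
    using (sum) renaming (_×_ to _·_)

  infix 4 _<_
  field
    _<_                  : Rel Carrier ℓ₂
    isStrictPartialOrder : IsStrictPartialOrder _≈_ _<_
    #⇒<⊎>                : ∀ {x y} → x # y → x < y ⊎ y < x
    <⇒#                  : ∀ {x y} → x < y → x # y
    +-monoʳ-<            : ∀ x {y z} → y < z → x + y < x + z
    *-pos                : ∀ {x y} → 0# < x → 0# < y → 0# < x * y
    0<1                  : 0# < 1#
    archimedean          : ∀ x → ∃[ m ] x < m · 1#

  -- |x - y| < ε
  Close : Carrier → Carrier → Carrier → Set ℓ₂
  Close ε x y = (x - y < ε) × (y - x < ε)

  Cauchy : (ℕ → Carrier) → Set (c ⊔ ℓ₂)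
  Cauchy a = ∀ ε → 0# < ε → ∃[ N ] ∀ i j → N ≤ i → N ≤ j → Close ε (a i) (a j)

  _⟶_ : (ℕ → Carrier) → Carrier → Set (c ⊔ ℓ₂)
  a ⟶ l = ∀ ε → 0# < ε → ∃[ N ] ∀ i → N ≤ i → Close ε (a i) l

  field
    complete : ∀ a → Cauchy a → ∃[ l ] a ⟶ l

  private
    module < = IsStrictPartialOrder isStrictPartialOrder

  0<m·1 : ∀ m → .{{NonZero m}} → 0# < m · 1#
  0<m·1 (suc zero)    = <.<-respʳ-≈ (sym (+-identityʳ 1#)) 0<1
  0<m·1 (suc (suc m)) = <.trans 0<1
    (<.<-respˡ-≈ (+-identityʳ 1#) (+-monoʳ-< 1# (0<m·1 (suc m))))

  ·-invertible : ∀ m → .{{NonZero m}} →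
                 Algebra.Definitions.Invertible _≈_ 1# _*_ (m · 1#)
  ·-invertible m with i , i*x≈1 , x*i≈1 ← #⇒invertible (#-sym (<⇒# (0<m·1 m))) =
    i , trans (*-congˡ (sym x-0≈x)) i*x≈1 , trans (*-congʳ (sym x-0≈x)) x*i≈1
    where
    open Algebra.Properties.Ring ring using (-0#≈0#)
    x-0≈x : m · 1# - 0# ≈ m · 1#
    x-0≈x = trans (+-congˡ -0#≈0#) (+-identityʳ (m · 1#))

  infixl 7 _÷_
  _÷_ : Carrier → (m : ℕ) → .{{NonZero m}} → Carrier
  x ÷ m = x * proj₁ (·-invertible m)

  Σ[_] : ∀ {a} {A : Set a} → List A → (A → Carrier) → Carrier
  Σ[ xs ] f = foldr (λ x s → f x + s) 0# xs

X : ℕ → Set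
X n = Vec Bool n

-- B⟨ x ⟩ = { i : xᵢ = 1 }.  A `Subset n` is by definition its characteristic
-- vector (with inside = true), so this is the identity on representations.
B⟨_⟩ : X n → Subset n
B⟨ x ⟩ = x

points : ∀ n → List (X n)
points zero    = [] ∷ []
points (suc n) = map (false ∷_) (points n) ++ map (true ∷_) (points n)

shell : ∀ n → ℕ → List (X n)
shell n r = filter (λ x → ∣ B⟨ x ⟩ ∣ ≟ r) (points n)

∈-points : (x : X n) → x ∈ points n
∈-points []          = here refl
∈-points (false ∷ x) = ∈-++⁺ˡ (∈-map⁺ (false ∷_) (∈-points x))
∈-points (true  ∷ x) = ∈-++⁺ʳ _ (∈-map⁺ (true ∷_) (∈-points x))

ofWeight : ∀ {r} → r ≤ n → ∃[ x ] ∣ B⟨_⟩ {n} x ∣ ≡ r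
ofWeight {zero}  z≤n       = [] , refl
ofWeight {suc n} z≤n       with x , eq ← ofWeight {n} z≤n = false ∷ x , eq
ofWeight         (s≤s r≤n) with x , eq ← ofWeight r≤n = true ∷ x , ≡.cong suc eq

length-nonZero : ∀ {A : Set} {x : A} {xs} → x ∈ xs → NonZero (length xs)
length-nonZero (here  _) = _
length-nonZero (there _) = _

∣shell∣-nonZero : ∀ {r} → r ≤ n → NonZero (length (shell n r))
∣shell∣-nonZero r≤n with x , eq ← ofWeight r≤n =
  length-nonZero (∈-filter⁺ (λ x → ∣ B⟨ x ⟩ ∣ ≟ _) (∈-points x) eq)

-- Sets of blocks (and sets of points) are decidable predicates, so that they
-- are finite and can be counted and summed over.

-- `points n` also enumerates all subsets of V, via B⟨_⟩.
#blocks⊇ : (𝓑 : Pred (Subset n) 0ℓ) → Decidable 𝓑 → Subset n → ℕ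
#blocks⊇ {n} 𝓑 𝓑? S =
  length (filter (λ C → 𝓑? C ×-dec S ⊆? C) (map B⟨_⟩ (points n)))

-- s-(n,k,μ) design on V = Fin n
record IsDesign (s n k μ : ℕ) (𝓑 : Pred (Subset n) 0ℓ) (𝓑? : Decidable 𝓑) : Set where
  field
    s≤k      : s ≤ k
    k≤n      : k ≤ n
    uniform  : ∀ C → 𝓑 C → ∣ C ∣ ≡ k
    balanced : ∀ S → ∣ S ∣ ≡ s → #blocks⊇ 𝓑 𝓑? S ≡ μ

Complementary : Pred (Subset n) 0ℓ → Pred (Subset n) 0ℓ
Complementary 𝓑 D = ∃[ C ] 𝓑 C × D ≡ ∁ C

complementary? : {𝓑 : Pred (Subset n) 0ℓ} → Decidable 𝓑 → Decidable (Complementary 𝓑)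
complementary? 𝓑? D = anySubset? (λ C → 𝓑? C ×-dec ≡-dec Bool._≟_ D (∁ C))

PointsOf : Pred (Subset n) 0ℓ → Pred (X n) 0ℓ
PointsOf 𝓑 x = 𝓑 B⟨ x ⟩

pointsOf? : {𝓑 : Pred (Subset n) 0ℓ} → Decidable 𝓑 → Decidable (PointsOf 𝓑)
pointsOf? 𝓑? x = 𝓑? B⟨ x ⟩

module _ {c ℓ₁ ℓ₂} (R : Reals c ℓ₁ ℓ₂) where
  open Reals R using (Carrier; _≈_; _<_; _*_; 0#; 1#; sum; _÷_; Σ[_])

  f⟨_⟩ : X n → X n → Carrier
  f⟨ z ⟩ x = if does (B⟨ z ⟩ ⊆? B⟨ x ⟩) then 1# else 0#

  -- (Y , w) is a relative t-design with respect to u₀ on the shells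
  -- X_{r 0} ∪ … ∪ X_{r (p-1)} of H(n,2).  Only the values of w on Y matter.
  record IsRelativeDesign {n p : ℕ} (t : ℕ) (r : Fin p → ℕ)
                          (Y : Pred (X n) 0ℓ) (Y? : Decidable Y)
                          (w : X n → Carrier) : Set (c ⊔ ℓ₁ ⊔ ℓ₂) where
    w[Y_] : ℕ → Carrier
    w[Y k ] = Σ[ filter Y? (shell n k) ] w

    field
      r≤n      : ∀ ν → r ν ≤ n
      distinct : Injective _≡_ _≡_ r
      Y⊆shells : ∀ x → Y x → ∃[ ν ] ∣ B⟨ x ⟩ ∣ ≡ r ν
      w-pos    : ∀ y → Y y → 0# < w y
      balanced : ∀ j → 1 ≤ j → j ≤ t → ∀ z → ∣ B⟨ z ⟩ ∣ ≡ j →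
        sum (λ ν → (w[Y r ν ] ÷ length (shell n (r ν))) {{∣shell∣-nonZero (r≤n ν)}}
                   * Σ[ shell n (r ν) ] f⟨ z ⟩)
        ≈ Σ[ filter Y? (points n) ] (λ y → w y * f⟨ z ⟩ y)

{-# OPTIONS --safe #-}

-- Let χ and σ be the indicators of 𝓑ᵣ and of the shell X_r, b = |𝓑ᵣ| and
-- N = |X_r|.  The integer function D = N χ − b σ has total 0, lives on sets of
-- size r, and its sum U(z) over the supersets of z is constant on 2e-sets.
-- Double counting the pairs (i, C) with i ∉ z and z ∪ {i} ⊆ C makes U constant
-- on smaller sets, and then, upwards from U(∅) = 0, zero on all sets of size
-- ≤ 2e.  Hence the sum of D over the sets disjoint from z, expanded by
-- inclusion–exclusion, reduces to (−1)^|z| U(z) when |z| ≤ 2e + 1, so the two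
-- sums cancel: both are 0 if |z| ≤ 2e, and the sign is odd if |z| = 2e + 1.
-- Complementation turns this cancellation into the design equation.
module Submission where

open import Defs
open import Level using (0ℓ)
open import Data.Fin.Subset using (Subset)
open import Data.Nat using (ℕ; _≤_; _+_; _*_; _∸_)
open import Data.Vec.Functional using (_∷_; [])
open import Relation.Binary.PropositionalEquality using (_≢_)
open import Relation.Unary using (Pred; Decidable; _∪_)
open import Relation.Unary.Properties using (_∪?_)

open import Algebra.Bundles using (CommutativeRing)
import Algebra.Lattice.Properties.BooleanAlgebra
import Algebra.Properties.CommutativeSemigroup
import Algebra.Properties.Semiring.Mult
open import Data.Bool.Base using (Bool; true; false; _∧_; if_then_else_)
open import Data.Bool.Properties using (∧-zeroʳ; ∧-identityʳ)
open import Data.Fin.Base using (zero; suc)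
open import Data.Fin.Subset using (∁; ∣_∣; ⊥)
open import Data.Fin.Subset.Properties using (∣∁p∣≡n∸∣p∣; ∣p∣≤n; _⊆?_; ∪-∩-booleanAlgebra)
open import Data.Integer.Base as ℤ using (ℤ; +_; 0ℤ; 1ℤ; -1ℤ)
import Data.Integer.Properties as ℤ
open import Data.Integer.Tactic.RingSolver using (solve-∀)
open import Data.List.Base as List using (List; length; filter; map)
import Data.List.Properties as List
open import Data.Nat.Base as ℕ using (zero; suc; _<_; z≤n; s≤s; NonZero)
import Data.Nat.Properties as ℕ
open import Data.Product.Base using (∃-syntax; _×_; _,_; proj₁; proj₂)
open import Data.Sum.Base using (_⊎_; inj₁; inj₂)
open import Data.Vec.Base using () renaming (_∷_ to _∷ᵛ_; [] to []ᵛ)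
open import Function.Base using (_∘_)
open import Function.Bundles using (_⇔_; mk⇔; Equivalence)
open import Relation.Binary.PropositionalEquality
  using (_≡_; refl; sym; trans; cong; cong₂; subst; _≗_; module ≡-Reasoning)
open import Relation.Nullary.Decidable using (yes; no; does; does-⇔; _×-dec_)
open import Relation.Nullary.Negation using (contradiction)

private
  variable
    n : ℕ

open Algebra.Properties.CommutativeSemigroup ℤ.+-commutativeSemigroup using (interchange)

-- Integer functions on subsets and their superset sums.

infixl 9 _↾_

_↾_ : {A : Set} → (X (suc n) → A) → Bool → X n → A
(f ↾ b) x = f (b ∷ᵛ x)

-- Σ⊇ D z = Σ_{C ⊇ z} D C
Σ⊇ : (X n → ℤ) → X n → ℤ
Σ⊇ D []ᵛ          = D []ᵛ
Σ⊇ D (false ∷ᵛ z) = Σ⊇ (D ↾ false) z ℤ.+ Σ⊇ (D ↾ true) z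
Σ⊇ D (true  ∷ᵛ z) = Σ⊇ (D ↾ true) z

Σ⊇-cong : {D E : X n → ℤ} → D ≗ E → Σ⊇ D ≗ Σ⊇ E
Σ⊇-cong D≗E []ᵛ          = D≗E []ᵛ
Σ⊇-cong D≗E (false ∷ᵛ z) =
  cong₂ ℤ._+_ (Σ⊇-cong (D≗E ∘ (false ∷ᵛ_)) z) (Σ⊇-cong (D≗E ∘ (true ∷ᵛ_)) z)
Σ⊇-cong D≗E (true  ∷ᵛ z) = Σ⊇-cong (D≗E ∘ (true ∷ᵛ_)) z

Σ⊇-+ : ∀ (D E : X n → ℤ) z → Σ⊇ (λ x → D x ℤ.+ E x) z ≡ Σ⊇ D z ℤ.+ Σ⊇ E z
Σ⊇-+ D E []ᵛ          = refl
Σ⊇-+ D E (false ∷ᵛ z) =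
  trans (cong₂ ℤ._+_ (Σ⊇-+ (D ↾ false) (E ↾ false) z) (Σ⊇-+ (D ↾ true) (E ↾ true) z))
        (interchange (Σ⊇ (D ↾ false) z) _ _ _)
Σ⊇-+ D E (true  ∷ᵛ z) = Σ⊇-+ (D ↾ true) (E ↾ true) z

Σ⊇-* : ∀ a (D : X n → ℤ) z → Σ⊇ (λ x → a ℤ.* D x) z ≡ a ℤ.* Σ⊇ D z
Σ⊇-* a D []ᵛ          = refl
Σ⊇-* a D (false ∷ᵛ z) =
  trans (cong₂ ℤ._+_ (Σ⊇-* a (D ↾ false) z) (Σ⊇-* a (D ↾ true) z))
        (sym (ℤ.*-distribˡ-+ a _ _))
Σ⊇-* a D (true  ∷ᵛ z) = Σ⊇-* a (D ↾ true) z

Σ⊇-zero : (z : X n) → Σ⊇ (λ _ → 0ℤ) z ≡ 0ℤ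
Σ⊇-zero []ᵛ          = refl
Σ⊇-zero (false ∷ᵛ z) = cong₂ ℤ._+_ (Σ⊇-zero z) (Σ⊇-zero z)
Σ⊇-zero (true  ∷ᵛ z) = Σ⊇-zero z

-- Complementation permutes all the points and, in each coordinate, only exchanges the two halves of
-- the total. This later gives both shells the same size and both halves of the block set the same
-- number of blocks.
Σ⊇-⊥-∁ : (D : X n → ℤ) → Σ⊇ (D ∘ ∁) ⊥ ≡ Σ⊇ D ⊥
Σ⊇-⊥-∁ {zero}  D = refl
Σ⊇-⊥-∁ {suc n} D =
  trans (cong₂ ℤ._+_ (Σ⊇-⊥-∁ (D ↾ true)) (Σ⊇-⊥-∁ (D ↾ false)))
        (ℤ.+-comm (Σ⊇ (D ↾ true) ⊥) _)

∣z∣≡0⇒z≡⊥ : (z : X n) → ∣ z ∣ ≡ 0 → z ≡ ⊥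
∣z∣≡0⇒z≡⊥ []ᵛ            _  = refl
∣z∣≡0⇒z≡⊥ (false ∷ᵛ z) eq = cong (false ∷ᵛ_) (∣z∣≡0⇒z≡⊥ z eq)

-- Inclusion-exclusion under complementation.

-- If the sums over supersets of all smaller sets vanish, only the full term
-- of the inclusion–exclusion formula for Σ_{C ∩ z = ∅} D C survives.
Σ⊇-∁ : (D : X n → ℤ) (z : X n) → (∀ y → ∣ y ∣ < ∣ z ∣ → Σ⊇ D y ≡ 0ℤ) →
       Σ⊇ (D ∘ ∁) z ≡ -1ℤ ℤ.^ ∣ z ∣ ℤ.* Σ⊇ D z
Σ⊇-∁ D []ᵛ _ = sym (ℤ.*-identityˡ (D []ᵛ))
Σ⊇-∁ D (false ∷ᵛ z) below = begin
  Σ⊇ (D₁ ∘ ∁) z ℤ.+ Σ⊇ (D₀ ∘ ∁) z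
    ≡⟨ ℤ.+-comm (Σ⊇ (D₁ ∘ ∁) z) _ ⟩
  Σ⊇ (D₀ ∘ ∁) z ℤ.+ Σ⊇ (D₁ ∘ ∁) z
    ≡⟨ sym (Σ⊇-+ (D₀ ∘ ∁) (D₁ ∘ ∁) z) ⟩
  Σ⊇ (λ x → D₀ (∁ x) ℤ.+ D₁ (∁ x)) z
    -- A coordinate outside `z` is free, so it is summed out: the superset sum of `D₀ + D₁` at `y`
    -- is that of `D` at `false ∷ᵛ y`, and the smallness hypothesis carries over.
    ≡⟨ Σ⊇-∁ (λ x → D₀ x ℤ.+ D₁ x) z
         (λ y y<z → trans (Σ⊇-+ D₀ D₁ y) (below (false ∷ᵛ y) y<z)) ⟩
  -1ℤ ℤ.^ ∣ z ∣ ℤ.* Σ⊇ (λ x → D₀ x ℤ.+ D₁ x) z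
    ≡⟨ cong (-1ℤ ℤ.^ ∣ z ∣ ℤ.*_) (Σ⊇-+ D₀ D₁ z) ⟩
  -1ℤ ℤ.^ ∣ z ∣ ℤ.* (Σ⊇ D₀ z ℤ.+ Σ⊇ D₁ z) ∎
  where
  open ≡-Reasoning
  D₀ = D ↾ false
  D₁ = D ↾ true
Σ⊇-∁ D (true ∷ᵛ z) below = begin
  Σ⊇ (D₀ ∘ ∁) z
    ≡⟨ Σ⊇-∁ D₀ z (λ y y<z → difference y (below (false ∷ᵛ y) (ℕ.m<n⇒m<1+n y<z))
                                          (below (true ∷ᵛ y) (s≤s y<z))) ⟩
  ε ℤ.* Σ⊇ D₀ z
    ≡⟨ split ε (Σ⊇ D₀ z) (Σ⊇ D₁ z) ⟩
  ε ℤ.* (Σ⊇ D₀ z ℤ.+ Σ⊇ D₁ z) ℤ.+ -1ℤ ℤ.* ε ℤ.* Σ⊇ D₁ z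
    -- Removing the first element from the set leaves a smaller one, so the sum of the two halves
    -- vanishes. Hence `D₀` may be traded for `D₁` at the cost of one sign.
    ≡⟨ cong (λ s → ε ℤ.* s ℤ.+ -1ℤ ℤ.* ε ℤ.* Σ⊇ D₁ z) (below (false ∷ᵛ z) ℕ.≤-refl) ⟩
  ε ℤ.* 0ℤ ℤ.+ -1ℤ ℤ.* ε ℤ.* Σ⊇ D₁ z
    ≡⟨ cong (ℤ._+ -1ℤ ℤ.* ε ℤ.* Σ⊇ D₁ z) (ℤ.*-zeroʳ ε) ⟩
  0ℤ ℤ.+ -1ℤ ℤ.* ε ℤ.* Σ⊇ D₁ z
    ≡⟨ ℤ.+-identityˡ _ ⟩
  -1ℤ ℤ.* ε ℤ.* Σ⊇ D₁ z ∎
  where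
  open ≡-Reasoning
  D₀ = D ↾ false
  D₁ = D ↾ true
  ε  = -1ℤ ℤ.^ ∣ z ∣
  split : ∀ ε p q → ε ℤ.* p ≡ ε ℤ.* (p ℤ.+ q) ℤ.+ -1ℤ ℤ.* ε ℤ.* q
  split = solve-∀
  difference : ∀ y → Σ⊇ D₀ y ℤ.+ Σ⊇ D₁ y ≡ 0ℤ → Σ⊇ D₁ y ≡ 0ℤ → Σ⊇ D₀ y ≡ 0ℤ
  difference y p+q≡0 q≡0 =
    trans (sym (ℤ.+-identityʳ _)) (trans (cong (λ q → Σ⊇ D₀ y ℤ.+ q) (sym q≡0)) p+q≡0)

-1^odd : ∀ e → -1ℤ ℤ.^ (2 * e + 1) ≡ -1ℤ
-1^odd e = begin
  -1ℤ ℤ.^ (2 * e + 1)              ≡⟨ ℤ.^-distribˡ-+-* -1ℤ (2 * e) 1 ⟩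
  -1ℤ ℤ.^ (2 * e) ℤ.* -1ℤ          ≡⟨ cong (ℤ._* -1ℤ) (sym (ℤ.^-*-assoc -1ℤ 2 e)) ⟩
  1ℤ ℤ.^ e ℤ.* -1ℤ                 ≡⟨ cong (ℤ._* -1ℤ) (ℤ.^-zeroˡ e) ⟩
  -1ℤ ∎
  where open ≡-Reasoning

-- Double counting over one-element extensions.

-- Σ⋗ D z = Σ_{i ∉ z} Σ⊇ D (z ∪ {i})
Σ⋗ : (X n → ℤ) → X n → ℤ
Σ⋗ D []ᵛ          = 0ℤ
Σ⋗ D (false ∷ᵛ z) =
  Σ⊇ (D ↾ true) z ℤ.+ (Σ⋗ (D ↾ false) z ℤ.+ Σ⋗ (D ↾ true) z)
Σ⋗ D (true  ∷ᵛ z) = Σ⋗ (D ↾ true) z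

Σ⋗-+ : ∀ (D E : X n → ℤ) z → Σ⋗ (λ x → D x ℤ.+ E x) z ≡ Σ⋗ D z ℤ.+ Σ⋗ E z
Σ⋗-+ D E []ᵛ          = refl
Σ⋗-+ D E (false ∷ᵛ z) =
  trans (cong₂ ℤ._+_ (Σ⊇-+ (D ↾ true) (E ↾ true) z)
          (trans (cong₂ ℤ._+_ (Σ⋗-+ (D ↾ false) (E ↾ false) z) (Σ⋗-+ (D ↾ true) (E ↾ true) z))
                 (interchange (Σ⋗ (D ↾ false) z) _ _ _)))
        (interchange (Σ⊇ (D ↾ true) z) _ _ _)
Σ⋗-+ D E (true  ∷ᵛ z) = Σ⋗-+ (D ↾ true) (E ↾ true) z

-- The factor `∣ x ∣` counts the elements `i` of `x`. Each `i` in `z` contributes the whole superset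
-- sum of `z`, and each `i` outside `z` contributes that of `z ∪ {i}`.
Σ⊇-∣∣* : (D : X n → ℤ) (z : X n) →
  Σ⊇ (λ x → + ∣ x ∣ ℤ.* D x) z ≡ Σ⋗ D z ℤ.+ + ∣ z ∣ ℤ.* Σ⊇ D z

Σ⊇-∣∣*-true : (D : X (suc n) → ℤ) (z : X n) →
  Σ⊇ (λ x → + suc ∣ x ∣ ℤ.* (D ↾ true) x) z
  ≡ Σ⊇ (D ↾ true) z ℤ.+ (Σ⋗ (D ↾ true) z ℤ.+ + ∣ z ∣ ℤ.* Σ⊇ (D ↾ true) z)
Σ⊇-∣∣*-true D z = begin
  Σ⊇ (λ x → + suc ∣ x ∣ ℤ.* D₁ x) z
    ≡⟨ Σ⊇-cong (λ x → ℤ.suc-* (+ ∣ x ∣) (D₁ x)) z ⟩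
  Σ⊇ (λ x → D₁ x ℤ.+ + ∣ x ∣ ℤ.* D₁ x) z
    ≡⟨ Σ⊇-+ D₁ _ z ⟩
  Σ⊇ D₁ z ℤ.+ Σ⊇ (λ x → + ∣ x ∣ ℤ.* D₁ x) z
    ≡⟨ cong (λ s → Σ⊇ D₁ z ℤ.+ s) (Σ⊇-∣∣* D₁ z) ⟩
  Σ⊇ D₁ z ℤ.+ (Σ⋗ D₁ z ℤ.+ + ∣ z ∣ ℤ.* Σ⊇ D₁ z) ∎
  where
  open ≡-Reasoning
  D₁ = D ↾ true

Σ⊇-∣∣* D []ᵛ          = sym (ℤ.+-identityˡ _)
Σ⊇-∣∣* D (false ∷ᵛ z) =
  trans (cong₂ ℤ._+_ (Σ⊇-∣∣* (D ↾ false) z) (Σ⊇-∣∣*-true D z))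
        (arrange (+ ∣ z ∣) (Σ⋗ (D ↾ false) z) (Σ⊇ (D ↾ false) z)
                           (Σ⋗ (D ↾ true) z) (Σ⊇ (D ↾ true) z))
  where
  arrange : ∀ k p q r s → (p ℤ.+ k ℤ.* q) ℤ.+ (s ℤ.+ (r ℤ.+ k ℤ.* s))
                          ≡ (s ℤ.+ (p ℤ.+ r)) ℤ.+ k ℤ.* (q ℤ.+ s)
  arrange = solve-∀
Σ⊇-∣∣* D (true ∷ᵛ z) =
  trans (Σ⊇-∣∣*-true D z) (arrange (+ ∣ z ∣) (Σ⋗ (D ↾ true) z) (Σ⊇ (D ↾ true) z))
  where
  arrange : ∀ k p q → q ℤ.+ (p ℤ.+ k ℤ.* q) ≡ p ℤ.+ (1ℤ ℤ.+ k) ℤ.* q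
  arrange = solve-∀

-- There are `n − ∣ z ∣` one-element extensions of `z`, each contributing `κ`; the subtracted term
-- is moved to the left to avoid truncated subtraction.
Σ⋗-const : (D : X n → ℤ) (z : X n) (κ : ℤ) → (∀ y → ∣ y ∣ ≡ suc ∣ z ∣ → Σ⊇ D y ≡ κ) →
           Σ⋗ D z ℤ.+ + ∣ z ∣ ℤ.* κ ≡ + n ℤ.* κ
Σ⋗-const D []ᵛ κ const = refl
Σ⋗-const {suc n} D (false ∷ᵛ z) κ const = begin
  Σ⊇ D₁ z ℤ.+ (Σ⋗ D₀ z ℤ.+ Σ⋗ D₁ z) ℤ.+ + ∣ z ∣ ℤ.* κ
    -- One extension adds the first coordinate; all the others leave it free and are handled
    -- together through `D₀ + D₁`.
    ≡⟨ cong₂ (λ p q → p ℤ.+ q ℤ.+ + ∣ z ∣ ℤ.* κ) (const (true ∷ᵛ z) refl) (sym (Σ⋗-+ D₀ D₁ z)) ⟩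
  κ ℤ.+ Σ⋗ (λ x → D₀ x ℤ.+ D₁ x) z ℤ.+ + ∣ z ∣ ℤ.* κ
    ≡⟨ ℤ.+-assoc κ _ _ ⟩
  κ ℤ.+ (Σ⋗ (λ x → D₀ x ℤ.+ D₁ x) z ℤ.+ + ∣ z ∣ ℤ.* κ)
    ≡⟨ cong (λ s → κ ℤ.+ s) (Σ⋗-const (λ x → D₀ x ℤ.+ D₁ x) z κ
         (λ y eq → trans (Σ⊇-+ D₀ D₁ y) (const (false ∷ᵛ y) eq))) ⟩
  κ ℤ.+ + n ℤ.* κ
    ≡⟨ sym (ℤ.suc-* (+ n) κ) ⟩
  + suc n ℤ.* κ ∎
  where
  open ≡-Reasoning
  D₀ = D ↾ false
  D₁ = D ↾ true
Σ⋗-const {suc n} D (true ∷ᵛ z) κ const = begin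
  Σ⋗ D₁ z ℤ.+ + suc ∣ z ∣ ℤ.* κ
    ≡⟨ arrange (Σ⋗ D₁ z) (+ ∣ z ∣) κ ⟩
  κ ℤ.+ (Σ⋗ D₁ z ℤ.+ + ∣ z ∣ ℤ.* κ)
    ≡⟨ cong (λ s → κ ℤ.+ s) (Σ⋗-const D₁ z κ (λ y eq → const (true ∷ᵛ y) (cong suc eq))) ⟩
  κ ℤ.+ + n ℤ.* κ
    ≡⟨ sym (ℤ.suc-* (+ n) κ) ⟩
  + suc n ℤ.* κ ∎
  where
  open ≡-Reasoning
  D₁ = D ↾ true
  arrange : ∀ p k κ → p ℤ.+ (1ℤ ℤ.+ k) ℤ.* κ ≡ κ ℤ.+ (p ℤ.+ k ℤ.* κ)
  arrange = solve-∀

-- The unknown has net coefficient `r − s > 0`, which can be cancelled.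
linear-unique : ∀ a {c x y s r} → s < r →
  + r ℤ.* x ℤ.+ c ≡ a ℤ.+ + s ℤ.* x → + r ℤ.* y ℤ.+ c ≡ a ℤ.+ + s ℤ.* y → x ≡ y
linear-unique a {c} {x} {y} {s} s<r eqx eqy
  -- Here `suc d` is the difference `r − s`.
  with d , refl ← ℕ.m≤n⇒∃[o]m+o≡n s<r =
  ℤ.*-cancelˡ-≡ (+ suc d) x y (trans (solved x eqx) (sym (solved y eqy)))
  where
  open ≡-Reasoning
  left : ∀ s d c x → (1ℤ ℤ.+ d) ℤ.* x ≡ (1ℤ ℤ.+ (s ℤ.+ d)) ℤ.* x ℤ.+ c ℤ.- (s ℤ.* x ℤ.+ c)
  left = solve-∀
  right : ∀ a b c → a ℤ.+ b ℤ.- (b ℤ.+ c) ≡ a ℤ.- c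
  right = solve-∀
  solved : ∀ x → + suc (s + d) ℤ.* x ℤ.+ c ≡ a ℤ.+ + s ℤ.* x → + suc d ℤ.* x ≡ a ℤ.- c
  solved x eq = begin
    + suc d ℤ.* x                                         ≡⟨ left (+ s) (+ d) c x ⟩
    + suc (s + d) ℤ.* x ℤ.+ c ℤ.- (+ s ℤ.* x ℤ.+ c)       ≡⟨ cong (ℤ._- (+ s ℤ.* x ℤ.+ c)) eq ⟩
    a ℤ.+ + s ℤ.* x ℤ.- (+ s ℤ.* x ℤ.+ c)                 ≡⟨ right a (+ s ℤ.* x) c ⟩
    a ℤ.- c                                               ∎

-- Vanishing superset sums for a function supported on sets of size `r`.

module _ {r : ℕ} (r≤n : r ≤ n) (D : X n → ℤ) (supported : ∀ x → + ∣ x ∣ ℤ.* D x ≡ + r ℤ.* D x) where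

  -- On the support the size is `r`, so the size-weighted superset sum is also `r` times the plain
  -- one. Comparing the two evaluations yields `(r − ∣z∣) U(z) = (n − ∣z∣) κ`, where `U` is the
  -- superset sum of `D`.
  double-count : ∀ z κ → (∀ y → ∣ y ∣ ≡ suc ∣ z ∣ → Σ⊇ D y ≡ κ) →
    + r ℤ.* Σ⊇ D z ℤ.+ + ∣ z ∣ ℤ.* κ ≡ + n ℤ.* κ ℤ.+ + ∣ z ∣ ℤ.* Σ⊇ D z
  double-count z κ const = begin
    + r ℤ.* Σ⊇ D z ℤ.+ + ∣ z ∣ ℤ.* κ
      ≡⟨ cong (ℤ._+ + ∣ z ∣ ℤ.* κ) (sym (Σ⊇-* (+ r) D z)) ⟩
    Σ⊇ (λ x → + r ℤ.* D x) z ℤ.+ + ∣ z ∣ ℤ.* κ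
      ≡⟨ cong (ℤ._+ + ∣ z ∣ ℤ.* κ) (sym (Σ⊇-cong supported z)) ⟩
    Σ⊇ (λ x → + ∣ x ∣ ℤ.* D x) z ℤ.+ + ∣ z ∣ ℤ.* κ
      ≡⟨ cong (ℤ._+ + ∣ z ∣ ℤ.* κ) (Σ⊇-∣∣* D z) ⟩
    Σ⋗ D z ℤ.+ + ∣ z ∣ ℤ.* Σ⊇ D z ℤ.+ + ∣ z ∣ ℤ.* κ
      ≡⟨ swap (Σ⋗ D z) (+ ∣ z ∣ ℤ.* Σ⊇ D z) (+ ∣ z ∣ ℤ.* κ) ⟩
    Σ⋗ D z ℤ.+ + ∣ z ∣ ℤ.* κ ℤ.+ + ∣ z ∣ ℤ.* Σ⊇ D z
      ≡⟨ cong (ℤ._+ + ∣ z ∣ ℤ.* Σ⊇ D z) (Σ⋗-const D z κ const) ⟩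
    + n ℤ.* κ ℤ.+ + ∣ z ∣ ℤ.* Σ⊇ D z ∎
    where
    open ≡-Reasoning
    swap : ∀ p q t → p ℤ.+ q ℤ.+ t ≡ p ℤ.+ t ℤ.+ q
    swap = solve-∀

  ConstantOn VanishingUpTo : ℕ → Set
  ConstantOn    s = ∀ y z → ∣ y ∣ ≡ s → ∣ z ∣ ≡ s → Σ⊇ D y ≡ Σ⊇ D z
  VanishingUpTo s = ∀ z → ∣ z ∣ ≤ s → Σ⊇ D z ≡ 0ℤ

  module VanishingStep {s} (s<r : s < r) (const : ConstantOn (suc s)) where

    private
      s≤n : s ≤ n
      s≤n = ℕ.≤-trans (ℕ.<⇒≤ s<r) r≤n

      -- Sample sets of sizes `s` and `s + 1`: `y₁` fixes the common value `κ`, and `y₀` is where a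
      -- known zero is fed into the count.
      y₀ y₁ : X n
      y₀ = proj₁ (ofWeight s≤n)
      y₁ = proj₁ (ofWeight (ℕ.≤-trans s<r r≤n))

      κ = Σ⊇ D y₁

      constant : ∀ z → ∣ z ∣ ≡ suc s → Σ⊇ D z ≡ κ
      constant z eq = const z y₁ eq (proj₂ (ofWeight (ℕ.≤-trans s<r r≤n)))

      count : ∀ z → ∣ z ∣ ≡ s →
              + r ℤ.* Σ⊇ D z ℤ.+ + s ℤ.* κ ≡ + n ℤ.* κ ℤ.+ + s ℤ.* Σ⊇ D z
      count z ∣z∣≡s = subst
        (λ k → + r ℤ.* Σ⊇ D z ℤ.+ + k ℤ.* κ ≡ + n ℤ.* κ ℤ.+ + k ℤ.* Σ⊇ D z) ∣z∣≡s
        (double-count z κ (λ y eq → constant y (trans eq (cong suc ∣z∣≡s))))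

    constantOn : ConstantOn s
    constantOn y z ∣y∣≡s ∣z∣≡s = linear-unique (+ n ℤ.* κ) s<r (count y ∣y∣≡s) (count z ∣z∣≡s)

    -- Since the sum at `y₀` is 0, the count there reads `(n − s) κ = 0`, and `s < r ≤ n`. Both `κ`
    -- and 0 solve this equation, so they agree.
    vanishing : VanishingUpTo s → ∀ z → ∣ z ∣ ≡ suc s → Σ⊇ D z ≡ 0ℤ
    vanishing below z ∣z∣≡1+s = trans (constant z ∣z∣≡1+s)
      (linear-unique 0ℤ (ℕ.≤-trans s<r r≤n) count₀ zeros)
      where
      open ≡-Reasoning
      Σ⊇y₀≡0 : Σ⊇ D y₀ ≡ 0ℤ
      Σ⊇y₀≡0 = below y₀ (ℕ.≤-reflexive (proj₂ (ofWeight s≤n)))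

      count₀ : + n ℤ.* κ ℤ.+ 0ℤ ≡ 0ℤ ℤ.+ + s ℤ.* κ
      count₀ = begin
        + n ℤ.* κ ℤ.+ 0ℤ
          ≡⟨ cong (λ t → + n ℤ.* κ ℤ.+ t) (scaled s) ⟨
        + n ℤ.* κ ℤ.+ + s ℤ.* Σ⊇ D y₀
          ≡⟨ count y₀ (proj₂ (ofWeight s≤n)) ⟨
        + r ℤ.* Σ⊇ D y₀ ℤ.+ + s ℤ.* κ
          ≡⟨ cong (ℤ._+ + s ℤ.* κ) (scaled r) ⟩
        0ℤ ℤ.+ + s ℤ.* κ ∎
        where
        scaled : ∀ a → + a ℤ.* Σ⊇ D y₀ ≡ 0ℤ
        scaled a = trans (cong (+ a ℤ.*_) Σ⊇y₀≡0) (ℤ.*-zeroʳ (+ a))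

      zeros : + n ℤ.* 0ℤ ℤ.+ 0ℤ ≡ 0ℤ ℤ.+ + s ℤ.* 0ℤ
      zeros = trans (cong (ℤ._+ 0ℤ) (ℤ.*-zeroʳ (+ n)))
                    (sym (trans (ℤ.+-identityˡ _) (ℤ.*-zeroʳ (+ s))))

  -- Constancy is handed down to smaller sizes in the recursive call, and the zeros come back up as
  -- it returns, starting from the total at the empty set.
  Σ⊇-vanishes : Σ⊇ D ⊥ ≡ 0ℤ → ∀ s → s ≤ r →
    ConstantOn s → VanishingUpTo s
  Σ⊇-vanishes total zero    _   _     z ∣z∣≤0 =
    trans (cong (Σ⊇ D) (∣z∣≡0⇒z≡⊥ z (ℕ.n≤0⇒n≡0 ∣z∣≤0))) total
  Σ⊇-vanishes total (suc s) s<r const z ∣z∣≤1+s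
    with ℕ.m≤n⇒m<n∨m≡n ∣z∣≤1+s
       | Σ⊇-vanishes total s (ℕ.<⇒≤ s<r) (VanishingStep.constantOn s<r const)
  ... | inj₁ (s≤s ∣z∣≤s) | below = below z ∣z∣≤s
  ... | inj₂ ∣z∣≡1+s     | below = VanishingStep.vanishing s<r const below z ∣z∣≡1+s

-- Cancellation for `D = N χ − b σ`.

module _ {r : ℕ} (r≤n : r ≤ n) (χ σ : X n → ℤ)
  (χ-supported : ∀ x → + ∣ x ∣ ℤ.* χ x ≡ + r ℤ.* χ x)
  (σ-supported : ∀ x → + ∣ x ∣ ℤ.* σ x ≡ + r ℤ.* σ x)
  (e : ℕ) (2e≤r : 2 * e ≤ r)
  (χ-constant : ∀ y z → ∣ y ∣ ≡ 2 * e → ∣ z ∣ ≡ 2 * e → Σ⊇ χ y ≡ Σ⊇ χ z)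
  (σ-constant : ∀ y z → ∣ y ∣ ≡ 2 * e → ∣ z ∣ ≡ 2 * e → Σ⊇ σ y ≡ Σ⊇ σ z)
  where

  private
    N b : ℤ
    N = Σ⊇ σ ⊥
    b = Σ⊇ χ ⊥

    D : X n → ℤ
    D x = N ℤ.* χ x ℤ.+ ℤ.- b ℤ.* σ x

    Σ⊇-combine : ∀ (f g : X n → ℤ) z → Σ⊇ (λ x → N ℤ.* f x ℤ.+ ℤ.- b ℤ.* g x) z
                                       ≡ N ℤ.* Σ⊇ f z ℤ.+ ℤ.- b ℤ.* Σ⊇ g z
    Σ⊇-combine f g z =
      trans (Σ⊇-+ _ _ z) (cong₂ ℤ._+_ (Σ⊇-* N f z) (Σ⊇-* (ℤ.- b) g z))

    D-supported : ∀ x → + ∣ x ∣ ℤ.* D x ≡ + r ℤ.* D x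
    D-supported x = begin
      + ∣ x ∣ ℤ.* D x
        ≡⟨ expand (+ ∣ x ∣) N b (χ x) (σ x) ⟩
      N ℤ.* (+ ∣ x ∣ ℤ.* χ x) ℤ.+ ℤ.- b ℤ.* (+ ∣ x ∣ ℤ.* σ x)
        ≡⟨ cong₂ (λ p q → N ℤ.* p ℤ.+ ℤ.- b ℤ.* q) (χ-supported x) (σ-supported x) ⟩
      N ℤ.* (+ r ℤ.* χ x) ℤ.+ ℤ.- b ℤ.* (+ r ℤ.* σ x)
        ≡⟨ expand (+ r) N b (χ x) (σ x) ⟨
      + r ℤ.* D x ∎
      where
      open ≡-Reasoning
      expand : ∀ k N b p q → k ℤ.* (N ℤ.* p ℤ.+ ℤ.- b ℤ.* q)
                             ≡ N ℤ.* (k ℤ.* p) ℤ.+ ℤ.- b ℤ.* (k ℤ.* q)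
      expand = solve-∀

    D-total : Σ⊇ D ⊥ ≡ 0ℤ
    D-total = trans (Σ⊇-combine χ σ ⊥) (cancels N b)
      where
      cancels : ∀ N b → N ℤ.* b ℤ.+ ℤ.- b ℤ.* N ≡ 0ℤ
      cancels = solve-∀

    D-vanishes : ∀ z → ∣ z ∣ ≤ 2 * e → Σ⊇ D z ≡ 0ℤ
    D-vanishes = Σ⊇-vanishes r≤n D D-supported D-total (2 * e) 2e≤r λ y z ∣y∣≡2e ∣z∣≡2e →
      trans (Σ⊇-combine χ σ y)
        (trans (cong₂ (λ p q → N ℤ.* p ℤ.+ ℤ.- b ℤ.* q)
                      (χ-constant y z ∣y∣≡2e ∣z∣≡2e) (σ-constant y z ∣y∣≡2e ∣z∣≡2e))
               (sym (Σ⊇-combine χ σ z)))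

    antisymmetric : ∀ z → ∣ z ∣ ≤ 2 * e + 1 → Σ⊇ (D ∘ ∁) z ≡ -1ℤ ℤ.* Σ⊇ D z
    antisymmetric z ∣z∣≤2e+1 with ℕ.m≤n⇒m<n∨m≡n ∣z∣≤2e+1
    ... | inj₁ ∣z∣<2e+1 = begin
      Σ⊇ (D ∘ ∁) z                 ≡⟨ Σ⊇-∁ D z (λ y y<z → D-vanishes y (ℕ.≤-trans (ℕ.<⇒≤ y<z) ∣z∣≤2e)) ⟩
      -1ℤ ℤ.^ ∣ z ∣ ℤ.* Σ⊇ D z     ≡⟨ cong (-1ℤ ℤ.^ ∣ z ∣ ℤ.*_) (D-vanishes z ∣z∣≤2e) ⟩
      -1ℤ ℤ.^ ∣ z ∣ ℤ.* 0ℤ         ≡⟨ ℤ.*-zeroʳ (-1ℤ ℤ.^ ∣ z ∣) ⟩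
      -1ℤ ℤ.* 0ℤ                   ≡⟨ cong (-1ℤ ℤ.*_) (D-vanishes z ∣z∣≤2e) ⟨
      -1ℤ ℤ.* Σ⊇ D z               ∎
      where
      open ≡-Reasoning
      ∣z∣≤2e : ∣ z ∣ ≤ 2 * e
      ∣z∣≤2e = ℕ.≤-pred (subst (∣ z ∣ <_) (ℕ.+-comm (2 * e) 1) ∣z∣<2e+1)
    ... | inj₂ ∣z∣≡2e+1 =
      -- All sets smaller than `z` have at most `2 * e` elements, so only the top term is left, with
      -- an odd exponent.
      trans (Σ⊇-∁ D z λ y y<z → D-vanishes y
              (ℕ.≤-pred (subst (∣ y ∣ <_) (trans ∣z∣≡2e+1 (ℕ.+-comm (2 * e) 1)) y<z)))
            (cong (ℤ._* Σ⊇ D z) (trans (cong (-1ℤ ℤ.^_) ∣z∣≡2e+1) (-1^odd e)))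

  -- The sums of `D` and `D ∘ ∁` over the supersets of `z` add up to 0; separating the `χ` and `σ`
  -- terms gives the identity.
  balanced-sums : ∀ z → ∣ z ∣ ≤ 2 * e + 1 →
    b ℤ.* (Σ⊇ σ z ℤ.+ Σ⊇ (σ ∘ ∁) z) ≡ N ℤ.* (Σ⊇ χ z ℤ.+ Σ⊇ (χ ∘ ∁) z)
  balanced-sums z ∣z∣≤2e+1 = begin
    b ℤ.* (Σ⊇ σ z ℤ.+ Σ⊇ (σ ∘ ∁) z)
      ≡⟨ split N b (Σ⊇ χ z) (Σ⊇ (χ ∘ ∁) z) (Σ⊇ σ z) (Σ⊇ (σ ∘ ∁) z) ⟩
    N ℤ.* (Σ⊇ χ z ℤ.+ Σ⊇ (χ ∘ ∁) z) ℤ.- (d ℤ.+ (N ℤ.* Σ⊇ (χ ∘ ∁) z ℤ.+ ℤ.- b ℤ.* Σ⊇ (σ ∘ ∁) z))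
      ≡⟨ cong₂ (λ p q → N ℤ.* (Σ⊇ χ z ℤ.+ Σ⊇ (χ ∘ ∁) z) ℤ.- (p ℤ.+ q))
           (sym (Σ⊇-combine χ σ z))
           (trans (sym (Σ⊇-combine (χ ∘ ∁) (σ ∘ ∁) z)) (antisymmetric z ∣z∣≤2e+1)) ⟩
    N ℤ.* (Σ⊇ χ z ℤ.+ Σ⊇ (χ ∘ ∁) z) ℤ.- (Σ⊇ D z ℤ.+ -1ℤ ℤ.* Σ⊇ D z)
      ≡⟨ drop (N ℤ.* (Σ⊇ χ z ℤ.+ Σ⊇ (χ ∘ ∁) z)) (Σ⊇ D z) ⟩
    N ℤ.* (Σ⊇ χ z ℤ.+ Σ⊇ (χ ∘ ∁) z) ∎
    where
    open ≡-Reasoning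
    d = N ℤ.* Σ⊇ χ z ℤ.+ ℤ.- b ℤ.* Σ⊇ σ z
    split : ∀ N b p p′ q q′ → b ℤ.* (q ℤ.+ q′) ≡
      N ℤ.* (p ℤ.+ p′) ℤ.- (N ℤ.* p ℤ.+ ℤ.- b ℤ.* q ℤ.+ (N ℤ.* p′ ℤ.+ ℤ.- b ℤ.* q′))
    split = solve-∀
    drop : ∀ a d → a ℤ.- (d ℤ.+ -1ℤ ℤ.* d) ≡ a
    drop = solve-∀

-- From counts of listed points to superset sums of indicators.

⟦_⟧ : Bool → ℤ
⟦ b ⟧ = if b then 1ℤ else 0ℤ

-- levelSum h n j = Σ_{C ⊇ z} h |C| for any j-subset z of an n-set
levelSum : (ℕ → ℤ) → ℕ → ℕ → ℤ
levelSum h zero    _       = h 0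
levelSum h (suc n) zero    = levelSum h n zero ℤ.+ levelSum (h ∘ suc) n zero
levelSum h (suc n) (suc j) = levelSum (h ∘ suc) n j

-- The recursion of `levelSum` strips elements of `z` first. Because `j ≤ n`, some coordinate lies
-- outside `z`, and this splits the sum at it instead.
levelSum-suc : ∀ h n {j} → j ≤ n →
  levelSum h (suc n) j ≡ levelSum h n j ℤ.+ levelSum (h ∘ suc) n j
levelSum-suc h n       z≤n       = refl
levelSum-suc h (suc n) (s≤s j≤n) = levelSum-suc (h ∘ suc) n j≤n

-- Applied to the indicator of a shell, this shows that the full shell is balanced at every size of
-- `z`.
Σ⊇-level : ∀ h (z : X n) → Σ⊇ (λ x → h ∣ x ∣) z ≡ levelSum h n ∣ z ∣
Σ⊇-level h []ᵛ          = refl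
Σ⊇-level {suc n} h (false ∷ᵛ z) =
  trans (cong₂ ℤ._+_ (Σ⊇-level h z) (Σ⊇-level (h ∘ suc) z)) (sym (levelSum-suc h n (∣p∣≤n z)))
Σ⊇-level h (true  ∷ᵛ z) = Σ⊇-level (h ∘ suc) z

length-filter-map : ∀ {A B : Set} {P : Pred B 0ℓ} (P? : Decidable P) (f : A → B) xs →
  length (filter P? (map f xs)) ≡ length (filter (P? ∘ f) xs)
length-filter-map P? f List.[] = refl
length-filter-map P? f (x List.∷ xs) with does (P? (f x))
... | false = length-filter-map P? f xs
... | true  = cong suc (length-filter-map P? f xs)

length-filter-points : {P : Pred (X n) 0ℓ} (P? : Decidable P) →
  + length (filter P? (points n)) ≡ Σ⊇ (λ x → ⟦ does (P? x) ⟧) ⊥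
length-filter-points {zero}  P? with does (P? []ᵛ)
... | true  = refl
... | false = refl
length-filter-points {suc n} P? = begin
  + length (filter P? (points (suc n)))
    ≡⟨ cong (λ xs → + length xs) (List.filter-++ P? (map (false ∷ᵛ_) (points n)) _) ⟩
  + length (filter P? (map (false ∷ᵛ_) (points n)) List.++ filter P? (map (true ∷ᵛ_) (points n)))
    ≡⟨ cong +_ (List.length-++ (filter P? (map (false ∷ᵛ_) (points n)))) ⟩
  + length (filter P? (map (false ∷ᵛ_) (points n)))
    ℤ.+ + length (filter P? (map (true ∷ᵛ_) (points n)))
    ≡⟨ cong₂ ℤ._+_ (half false) (half true) ⟩
  Σ⊇ (λ x → ⟦ does (P? x) ⟧) ⊥ ∎
  where
  open ≡-Reasoning
  half : ∀ b → + length (filter P? (map (b ∷ᵛ_) (points n))) ≡ Σ⊇ (λ x → ⟦ does (P? (b ∷ᵛ x)) ⟧) ⊥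
  half b = trans (cong +_ (length-filter-map P? (b ∷ᵛ_) (points n)))
                 (length-filter-points (P? ∘ (b ∷ᵛ_)))

Σ⊇-filter : (p : X n → Bool) (z : X n) →
  Σ⊇ (λ x → ⟦ p x ∧ does (z ⊆? x) ⟧) ⊥ ≡ Σ⊇ (λ x → ⟦ p x ⟧) z
Σ⊇-filter p []ᵛ          = cong ⟦_⟧ (∧-identityʳ (p []ᵛ))
Σ⊇-filter p (false ∷ᵛ z) = cong₂ ℤ._+_ (Σ⊇-filter (p ↾ false) z) (Σ⊇-filter (p ↾ true) z)
Σ⊇-filter {suc n} p (true ∷ᵛ z) = begin
  Σ⊇ (λ x → ⟦ p (false ∷ᵛ x) ∧ false ⟧) ⊥ ℤ.+ Σ⊇ (λ x → ⟦ p (true ∷ᵛ x) ∧ does (z ⊆? x) ⟧) ⊥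
    ≡⟨ cong₂ ℤ._+_ (trans (Σ⊇-cong (λ x → cong ⟦_⟧ (∧-zeroʳ (p (false ∷ᵛ x)))) ⊥) (Σ⊇-zero (⊥ {n})))
                   (Σ⊇-filter (p ↾ true) z) ⟩
  0ℤ ℤ.+ Σ⊇ (λ x → ⟦ p (true ∷ᵛ x) ⟧) z
    ≡⟨ ℤ.+-identityˡ _ ⟩
  Σ⊇ (λ x → ⟦ p (true ∷ᵛ x) ⟧) z ∎
  where open ≡-Reasoning

filter-filter : ∀ {A : Set} {P Q : Pred A 0ℓ} (P? : Decidable P) (Q? : Decidable Q) →
  ∀ xs → filter Q? (filter P? xs) ≡ filter (λ x → P? x ×-dec Q? x) xs
filter-filter P? Q? List.[] = refl
filter-filter P? Q? (x List.∷ xs) with does (P? x)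
... | false = filter-filter P? Q? xs
... | true with does (Q? x)
...   | false = filter-filter P? Q? xs
...   | true  = cong (x List.∷_) (filter-filter P? Q? xs)

length-filter-⊇ : {P : Pred (X n) 0ℓ} (P? : Decidable P) (z : X n) →
  + length (filter (z ⊆?_) (filter P? (points n))) ≡ Σ⊇ (λ x → ⟦ does (P? x) ⟧) z
length-filter-⊇ P? z =
  trans (cong (λ xs → + length xs) (filter-filter P? (z ⊆?_) (points _)))
    (trans (length-filter-points (λ x → P? x ×-dec z ⊆? x)) (Σ⊇-filter (does ∘ P?) z))

∁-involutive : (x : X n) → ∁ (∁ x) ≡ x
∁-involutive {n} = ¬-involutive
  where open Algebra.Lattice.Properties.BooleanAlgebra (∪-∩-booleanAlgebra n)

-- Either the indicator is 0 or the size is `r`. This linear form of the support condition is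
-- inherited by combinations of `χ` and `σ`.
indicator-supported : ∀ {r} {P : Pred (X n) 0ℓ} (P? : Decidable P) → (∀ x → P x → ∣ x ∣ ≡ r) →
  ∀ x → + ∣ x ∣ ℤ.* ⟦ does (P? x) ⟧ ≡ + r ℤ.* ⟦ does (P? x) ⟧
indicator-supported {r = r} P? uniform x with P? x
... | yes Px = cong (λ k → + k ℤ.* 1ℤ) (uniform x Px)
... | no  _  = trans (ℤ.*-zeroʳ (+ ∣ x ∣)) (sym (ℤ.*-zeroʳ (+ r)))

-- Counts for the design, its complement and the two shells.

module _ (e : ℕ) {r μ : ℕ} {𝓑 : Pred (Subset n) 0ℓ} (𝓑? : Decidable 𝓑)
  (design : IsDesign (2 * e) n r μ 𝓑 𝓑?) (r≢n∸r : r ≢ n ∸ r) where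

  open IsDesign design

  private
    Y : Pred (X n) 0ℓ
    Y = PointsOf (𝓑 ∪ Complementary 𝓑)

    Y? : Decidable Y
    Y? = pointsOf? (𝓑? ∪? complementary? 𝓑?)

    χ σ : X n → ℤ
    χ x = ⟦ does (𝓑? x) ⟧
    σ x = ⟦ does (∣ x ∣ ℕ.≟ r) ⟧

    ∣x∣≡n∸r⇔∣∁x∣≡r : (x : X n) → (∣ x ∣ ≡ n ∸ r) ⇔ (∣ ∁ x ∣ ≡ r)
    ∣x∣≡n∸r⇔∣∁x∣≡r x = mk⇔
      (λ eq → trans (∣∁p∣≡n∸∣p∣ x) (trans (cong (n ∸_) eq) (ℕ.m∸[m∸n]≡n k≤n)))
      (λ eq → trans (cong ∣_∣ (sym (∁-involutive x))) (trans (∣∁p∣≡n∸∣p∣ (∁ x)) (cong (n ∸_) eq)))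

    Complementary⇒ : ∀ {x} → Complementary 𝓑 x → 𝓑 (∁ x)
    Complementary⇒ (C , C∈𝓑 , refl) = subst 𝓑 (sym (∁-involutive C)) C∈𝓑

    Complementary⇐ : ∀ {x} → 𝓑 (∁ x) → Complementary 𝓑 x
    Complementary⇐ {x} ∁x∈𝓑 = ∁ x , ∁x∈𝓑 , sym (∁-involutive x)

    ∣complement∣ : ∀ {x} → 𝓑 (∁ x) → ∣ x ∣ ≡ n ∸ r
    ∣complement∣ {x} ∁x∈𝓑 = Equivalence.from (∣x∣≡n∸r⇔∣∁x∣≡r x) (uniform (∁ x) ∁x∈𝓑)

    -- As `r ≢ n ∸ r`, a complementary block has the wrong size for this shell.
    Y∩shell-r : ∀ x → (∣ x ∣ ≡ r × Y x) ⇔ 𝓑 x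
    Y∩shell-r x = mk⇔
      (λ { (_    , inj₁ x∈𝓑) → x∈𝓑
         ; (∣x∣≡r , inj₂ x∈𝓒) →
             contradiction (trans (sym ∣x∣≡r) (∣complement∣ (Complementary⇒ x∈𝓒))) r≢n∸r })
      (λ x∈𝓑 → uniform x x∈𝓑 , inj₁ x∈𝓑)

    Y∩shell-n∸r : ∀ x → (∣ x ∣ ≡ n ∸ r × Y x) ⇔ 𝓑 (∁ x)
    Y∩shell-n∸r x = mk⇔
      (λ { (∣x∣≡n∸r , inj₁ x∈𝓑) → contradiction (trans (sym (uniform x x∈𝓑)) ∣x∣≡n∸r) r≢n∸r
         ; (_       , inj₂ x∈𝓒) → Complementary⇒ x∈𝓒 })
      (λ ∁x∈𝓑 → ∣complement∣ ∁x∈𝓑 , inj₂ (Complementary⇐ ∁x∈𝓑))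

    -- The two families have different block sizes, so their union is disjoint and the indicators
    -- add.
    Y-indicator : ∀ x → ⟦ does (Y? x) ⟧ ≡ χ x ℤ.+ χ (∁ x)
    Y-indicator x with 𝓑? x | complementary? 𝓑? x | 𝓑? (∁ x)
    ... | yes x∈𝓑 | _       | yes ∁x∈𝓑 =
      contradiction (trans (sym (uniform x x∈𝓑)) (∣complement∣ ∁x∈𝓑)) r≢n∸r
    ... | yes _   | _       | no  _    = refl
    ... | no  _   | yes _   | yes _    = refl
    ... | no  _   | no  x∉𝓒 | yes ∁x∈𝓑 = contradiction (Complementary⇐ ∁x∈𝓑) x∉𝓒
    ... | no  _   | yes x∈𝓒 | no  ∁x∉𝓑 = contradiction (Complementary⇒ x∈𝓒) ∁x∉𝓑
    ... | no  _   | no  _   | no  _    = refl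

    #Y∩shell : ∀ k {P : Pred (X n) 0ℓ} (P? : Decidable P) → (∀ x → (∣ x ∣ ≡ k × Y x) ⇔ P x) →
      + length (filter Y? (shell n k)) ≡ Σ⊇ (λ x → ⟦ does (P? x) ⟧) ⊥
    #Y∩shell k P? Y∩shell⇔P = begin
      + length (filter Y? (shell n k))
        ≡⟨ cong (λ xs → + length xs) (filter-filter (λ x → ∣ x ∣ ℕ.≟ k) Y? (points n)) ⟩
      + length (filter (λ x → (∣ x ∣ ℕ.≟ k) ×-dec Y? x) (points n))
        ≡⟨ length-filter-points (λ x → (∣ x ∣ ℕ.≟ k) ×-dec Y? x) ⟩
      Σ⊇ (λ x → ⟦ does ((∣ x ∣ ℕ.≟ k) ×-dec Y? x) ⟧) ⊥
        ≡⟨ Σ⊇-cong (λ x → cong ⟦_⟧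
             (does-⇔ (Y∩shell⇔P x) ((∣ x ∣ ℕ.≟ k) ×-dec Y? x) (P? x))) ⊥ ⟩
      Σ⊇ (λ x → ⟦ does (P? x) ⟧) ⊥ ∎
      where open ≡-Reasoning

    #shell⊇-r : ∀ z → + length (filter (z ⊆?_) (shell n r)) ≡ Σ⊇ σ z
    #shell⊇-r = length-filter-⊇ (λ x → ∣ x ∣ ℕ.≟ r)

    σ-∁ : ∀ x → ⟦ does (∣ x ∣ ℕ.≟ n ∸ r) ⟧ ≡ σ (∁ x)
    σ-∁ x = cong ⟦_⟧ (does-⇔ (∣x∣≡n∸r⇔∣∁x∣≡r x) (∣ x ∣ ℕ.≟ n ∸ r) (∣ ∁ x ∣ ℕ.≟ r))

    #shell⊇-n∸r : ∀ z → + length (filter (z ⊆?_) (shell n (n ∸ r))) ≡ Σ⊇ (σ ∘ ∁) z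
    #shell⊇-n∸r z = trans (length-filter-⊇ (λ x → ∣ x ∣ ℕ.≟ n ∸ r) z) (Σ⊇-cong σ-∁ z)

    #Y⊇ : ∀ z → + length (filter (z ⊆?_) (filter Y? (points n))) ≡ Σ⊇ χ z ℤ.+ Σ⊇ (χ ∘ ∁) z
    #Y⊇ z = trans (length-filter-⊇ Y? z) (trans (Σ⊇-cong Y-indicator z) (Σ⊇-+ χ (χ ∘ ∁) z))

    #Y∩shell-r : + length (filter Y? (shell n r)) ≡ Σ⊇ χ ⊥
    #Y∩shell-r = #Y∩shell r 𝓑? Y∩shell-r

    #shell-r : + length (shell n r) ≡ Σ⊇ σ ⊥
    #shell-r = length-filter-points {n} (λ x → ∣ x ∣ ℕ.≟ r)

    χ-balanced : ∀ z → ∣ z ∣ ≡ 2 * e → Σ⊇ χ z ≡ + μ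
    χ-balanced z ∣z∣≡2e = begin
      Σ⊇ χ z
        ≡⟨ Σ⊇-filter (does ∘ 𝓑?) z ⟨
      Σ⊇ (λ x → ⟦ does (𝓑? x ×-dec z ⊆? x) ⟧) ⊥
        ≡⟨ length-filter-points (λ x → 𝓑? x ×-dec z ⊆? x) ⟨
      + length (filter (λ x → 𝓑? x ×-dec z ⊆? x) (points n))
        ≡⟨ cong +_ (length-filter-map (λ x → 𝓑? x ×-dec z ⊆? x) B⟨_⟩ (points n)) ⟨
      + #blocks⊇ 𝓑 𝓑? z
        ≡⟨ cong +_ (balanced z ∣z∣≡2e) ⟩
      + μ ∎
      where open ≡-Reasoning

    σ-level : ∀ z → Σ⊇ σ z ≡ levelSum (λ k → ⟦ does (k ℕ.≟ r) ⟧) n ∣ z ∣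
    σ-level = Σ⊇-level (λ k → ⟦ does (k ℕ.≟ r) ⟧)

  ∣Y-shells∣ : length (filter Y? (shell n (n ∸ r))) ≡ length (filter Y? (shell n r))
  ∣Y-shells∣ = ℤ.+-injective (trans (#Y∩shell (n ∸ r) (𝓑? ∘ ∁) Y∩shell-n∸r)
    (trans (Σ⊇-⊥-∁ χ) (sym #Y∩shell-r)))

  ∣shells∣ : length (shell n (n ∸ r)) ≡ length (shell n r)
  ∣shells∣ = ℤ.+-injective (trans (length-filter-points {n} (λ x → ∣ x ∣ ℕ.≟ n ∸ r))
    (trans (Σ⊇-cong σ-∁ ⊥) (trans (Σ⊇-⊥-∁ σ) (sym #shell-r))))

  -- This is the design equation with the weight divided out and the common denominator, the shell
  -- size, cleared. The proof passes through ℤ, where `D` takes negative values.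
  balanced-counts : ∀ z → ∣ z ∣ ≤ 2 * e + 1 →
    length (filter Y? (shell n r)) * (length (filter (z ⊆?_) (shell n r))
                                      + length (filter (z ⊆?_) (shell n (n ∸ r))))
    ≡ length (shell n r) * length (filter (z ⊆?_) (filter Y? (points n)))
  balanced-counts z ∣z∣≤2e+1 = ℤ.+-injective (begin
    + (b * (s + s′))
      ≡⟨ ℤ.pos-* b (s + s′) ⟩
    + b ℤ.* (+ s ℤ.+ + s′)
      ≡⟨ cong₂ ℤ._*_ #Y∩shell-r (cong₂ ℤ._+_ (#shell⊇-r z) (#shell⊇-n∸r z)) ⟩
    Σ⊇ χ ⊥ ℤ.* (Σ⊇ σ z ℤ.+ Σ⊇ (σ ∘ ∁) z)
      ≡⟨ balanced-sums k≤n χ σ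
           (indicator-supported 𝓑? uniform)
           (indicator-supported (λ x → ∣ x ∣ ℕ.≟ r) (λ _ eq → eq))
           e s≤k
           (λ x y ∣x∣≡2e ∣y∣≡2e → trans (χ-balanced x ∣x∣≡2e) (sym (χ-balanced y ∣y∣≡2e)))
           (λ x y ∣x∣≡2e ∣y∣≡2e →
              trans (σ-level x) (trans (cong (levelSum _ n) (trans ∣x∣≡2e (sym ∣y∣≡2e)))
                                       (sym (σ-level y))))
           z ∣z∣≤2e+1 ⟩
    Σ⊇ σ ⊥ ℤ.* (Σ⊇ χ z ℤ.+ Σ⊇ (χ ∘ ∁) z)
      ≡⟨ cong₂ ℤ._*_ #shell-r (#Y⊇ z) ⟨
    + length (shell n r) ℤ.* + T
      ≡⟨ ℤ.pos-* (length (shell n r)) T ⟨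
    + (length (shell n r) * T) ∎)
    where
    open ≡-Reasoning
    b  = length (filter Y? (shell n r))
    s  = length (filter (z ⊆?_) (shell n r))
    s′ = length (filter (z ⊆?_) (shell n (n ∸ r)))
    T  = length (filter (z ⊆?_) (filter Y? (points n)))

  Y-shells : ∀ x → Y x → ∃[ ν ] ∣ x ∣ ≡ (r ∷ (n ∸ r) ∷ []) ν
  Y-shells x (inj₁ x∈𝓑) = zero , uniform x x∈𝓑
  Y-shells x (inj₂ x∈𝓒) = suc zero , ∣complement∣ (Complementary⇒ x∈𝓒)

-- Passage to real weights.

module _ {c ℓ₁ ℓ₂} (R : Reals c ℓ₁ ℓ₂) where
  open Reals R
    using (_≈_; 0#; 1#; _·_; _÷_; Σ[_]; ·-invertible; setoid; semiring)
    renaming (_+_ to _⊕_; _*_ to _⊛_)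
  private module R = Reals R
  open Algebra.Properties.CommutativeSemigroup
    (CommutativeRing.*-commutativeSemigroup R.commutativeRing) using (xy∙z≈xz∙y)
  open Algebra.Properties.Semiring.Mult semiring using (×-assoc-*; ×1-homo-*; ×-homo-+; ×-congʳ)
  open import Relation.Binary.Reasoning.Setoid setoid

  Σ-const : ∀ {A : Set} (xs : List A) w → Σ[ xs ] (λ _ → w) ≈ length xs · w
  Σ-const List.[]       w = R.refl
  Σ-const (_ List.∷ xs) w = R.+-congˡ (Σ-const xs w)

  Σ-*ˡ : ∀ {A : Set} (xs : List A) w f → Σ[ xs ] (λ x → w ⊛ f x) ≈ w ⊛ Σ[ xs ] f
  Σ-*ˡ List.[]       w f = R.sym (R.zeroʳ w)
  Σ-*ˡ (x List.∷ xs) w f = R.trans (R.+-congˡ (Σ-*ˡ xs w f)) (R.sym (R.distribˡ w (f x) _))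

  Σ-f⟨z⟩ : ∀ (xs : List (X n)) z → Σ[ xs ] (f⟨_⟩ R z) ≈ length (filter (z ⊆?_) xs) · 1#
  Σ-f⟨z⟩ List.[]       z = R.refl
  Σ-f⟨z⟩ (x List.∷ xs) z with does (z ⊆? x)
  ... | true  = R.+-congˡ (Σ-f⟨z⟩ xs z)
  ... | false = R.trans (R.+-identityˡ _) (Σ-f⟨z⟩ xs z)

  -- Both shells have the same mean weight `b w / N`, so it factors out and the integer identity
  -- finishes the computation.
  average : ∀ w b b′ N N′ s s′ T .{{_ : NonZero N}} .{{_ : NonZero N′}} →
    b′ ≡ b → N′ ≡ N → b * (s + s′) ≡ N * T →
    ((b · w) ÷ N) ⊛ (s · 1#) ⊕ (((b′ · w) ÷ N′) ⊛ (s′ · 1#) ⊕ 0#) ≈ w ⊛ (T · 1#)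
  -- The `NonZero` arguments are irrelevant, so once `N′` is identified with `N` both quotients use
  -- the same inverse `ι`.
  average w b b N N s s′ T refl refl b[s+s′]≡NT = begin
    (b · w ⊛ ι) ⊛ (s · 1#) ⊕ ((b · w ⊛ ι) ⊛ (s′ · 1#) ⊕ 0#)
      ≈⟨ R.+-congˡ (R.+-identityʳ _) ⟩
    (b · w ⊛ ι) ⊛ (s · 1#) ⊕ (b · w ⊛ ι) ⊛ (s′ · 1#)
      ≈⟨ R.distribˡ _ _ _ ⟨
    (b · w ⊛ ι) ⊛ (s · 1# ⊕ s′ · 1#)
      ≈⟨ R.*-cong (R.*-congʳ b·w≈w*b·1) (R.sym (×-homo-+ 1# s s′)) ⟩
    (w ⊛ b · 1# ⊛ ι) ⊛ ((s + s′) · 1#)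
      ≈⟨ R.*-congʳ (xy∙z≈xz∙y w (b · 1#) ι) ⟩
    (w ⊛ ι ⊛ b · 1#) ⊛ ((s + s′) · 1#)
      ≈⟨ R.*-assoc _ _ _ ⟩
    (w ⊛ ι) ⊛ (b · 1# ⊛ (s + s′) · 1#)
      ≈⟨ R.*-congˡ (×1-homo-* b (s + s′)) ⟨
    (w ⊛ ι) ⊛ ((b * (s + s′)) · 1#)
      ≡⟨ cong (λ m → (w ⊛ ι) ⊛ (m · 1#)) b[s+s′]≡NT ⟩
    (w ⊛ ι) ⊛ ((N * T) · 1#)
      ≈⟨ R.*-congˡ (×1-homo-* N T) ⟩
    (w ⊛ ι) ⊛ (N · 1# ⊛ T · 1#)
      ≈⟨ R.*-assoc w ι _ ⟩
    w ⊛ (ι ⊛ (N · 1# ⊛ T · 1#))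
      ≈⟨ R.*-congˡ (R.*-assoc ι _ _) ⟨
    w ⊛ ((ι ⊛ N · 1#) ⊛ T · 1#)
      ≈⟨ R.*-congˡ (R.*-congʳ (proj₁ (proj₂ (·-invertible N)))) ⟩
    w ⊛ (1# ⊛ T · 1#)
      ≈⟨ R.*-congˡ (R.*-identityˡ _) ⟩
    w ⊛ (T · 1#) ∎
    where
    ι = proj₁ (·-invertible N)
    b·w≈w*b·1 : b · w ≈ w ⊛ b · 1#
    b·w≈w*b·1 = R.trans (×-congʳ b (R.sym (R.*-identityˡ w)))
                  (R.trans (R.sym (×-assoc-* b 1# w)) (R.*-comm _ w))

theorem3p5 : ∀ {c ℓ₁ ℓ₂} (R : Reals c ℓ₁ ℓ₂) →
    (e n r μ : ℕ) → 1 ≤ e →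
    (𝓑ᵣ : Pred (Subset n) 0ℓ) (𝓑ᵣ? : Decidable 𝓑ᵣ) →
    IsDesign (2 * e) n r μ 𝓑ᵣ 𝓑ᵣ? →
    r ≢ n ∸ r →
    (w : Reals.Carrier R) → Reals._<_ R (Reals.0# R) w →
    IsRelativeDesign R (2 * e + 1) (r ∷ (n ∸ r) ∷ [])
    (PointsOf (𝓑ᵣ ∪ Complementary 𝓑ᵣ))
    (pointsOf? (𝓑ᵣ? ∪? complementary? 𝓑ᵣ?))
    (λ _ → w)
theorem3p5 R e n r μ _ 𝓑ᵣ 𝓑ᵣ? design r≢n∸r w 0<w = record
  { r≤n      = r≤n
  ; distinct = λ { {zero}     {zero}     _  → refl
                 ; {zero}     {suc zero} eq → contradiction eq r≢n∸r
                 ; {suc zero} {zero}     eq → contradiction (sym eq) r≢n∸r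
                 ; {suc zero} {suc zero} _  → refl }
  ; Y⊆shells = Y-shells e 𝓑ᵣ? design r≢n∸r
  ; w-pos    = λ _ _ → 0<w
  ; balanced = λ { _ _ j≤2e+1 z refl → balanced z j≤2e+1 }
  }
  where
  open Reals R using (_≈_; _·_; 1#; sum; _÷_; Σ[_]) renaming (_*_ to _⊛_)
  module R = Reals R
  Y? = pointsOf? (𝓑ᵣ? ∪? complementary? 𝓑ᵣ?)
  shells = r ∷ (n ∸ r) ∷ []

  r≤n : ∀ ν → shells ν ≤ n
  r≤n zero       = IsDesign.k≤n design
  r≤n (suc zero) = ℕ.m∸n≤m n r

  balanced : ∀ z → ∣ z ∣ ≤ 2 * e + 1 →
    sum (λ ν → (Σ[ filter Y? (shell n (shells ν)) ] (λ _ → w) ÷ length (shell n (shells ν)))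
                 {{∣shell∣-nonZero (r≤n ν)}}
               ⊛ Σ[ shell n (shells ν) ] (f⟨_⟩ R z))
    ≈ Σ[ filter Y? (points n) ] (λ y → w ⊛ f⟨_⟩ R z y)
  balanced z ∣z∣≤2e+1 = begin
    -- The sum over the two shells unfolds to two terms followed by `0#`, the shape that `average`
    -- expects.
    _ ≈⟨ R.+-cong (term zero) (R.+-congʳ (term (suc zero))) ⟩
    _ ≈⟨ average R w (length (filter Y? (shell n r))) (length (filter Y? (shell n (n ∸ r))))
           (length (shell n r)) (length (shell n (n ∸ r)))
           (length (filter (z ⊆?_) (shell n r))) (length (filter (z ⊆?_) (shell n (n ∸ r)))) _
           {{∣shell∣-nonZero (r≤n zero)}} {{∣shell∣-nonZero (r≤n (suc zero))}}
           (∣Y-shells∣ e 𝓑ᵣ? design r≢n∸r) (∣shells∣ e 𝓑ᵣ? design r≢n∸r)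
           (balanced-counts e 𝓑ᵣ? design r≢n∸r z ∣z∣≤2e+1) ⟩
    w ⊛ (length (filter (z ⊆?_) (filter Y? (points n))) · 1#)
      ≈⟨ R.*-congˡ (Σ-f⟨z⟩ R (filter Y? (points n)) z) ⟨
    w ⊛ Σ[ filter Y? (points n) ] (f⟨_⟩ R z)
      ≈⟨ Σ-*ˡ R (filter Y? (points n)) w (f⟨_⟩ R z) ⟨
    Σ[ filter Y? (points n) ] (λ y → w ⊛ f⟨_⟩ R z y) ∎
    where
    open import Relation.Binary.Reasoning.Setoid R.setoid
    term : ∀ ν →
      (Σ[ filter Y? (shell n (shells ν)) ] (λ _ → w) ÷ length (shell n (shells ν)))
        {{∣shell∣-nonZero (r≤n ν)}}
        ⊛ Σ[ shell n (shells ν) ] (f⟨_⟩ R z)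
      ≈ ((length (filter Y? (shell n (shells ν))) · w) ÷ length (shell n (shells ν)))
        {{∣shell∣-nonZero (r≤n ν)}}
        ⊛ (length (filter (z ⊆?_) (shell n (shells ν))) · 1#)
    term ν = R.*-cong (R.*-congʳ (Σ-const R (filter Y? (shell n (shells ν))) w))
                      (Σ-f⟨z⟩ R (shell n (shells ν)) z)
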